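{- For every (fixed, finite) graph $H$ with at least $6$ edges, there is a constant $b=b(H)>0$ such that $C(n,H)=\Omega(n^{b})$ as $n\to\infty$.
   Context: For a graph $H$ and a positive integer $n$, $C(n,H)$ denotes the minimum integer $k$ such that there exist $n$ colorings $f_v:E(K_n)\to[k]$, one for each vertex $v\in V(K_n)$ (the colorings need not be proper), with the following property: for every copy $T$ of $H$ in $K_n$, there is a vertex $v\in V(T)$ such that $f_v$ assigns pairwise distinct colors to all edges of $E(T)$. -}

module Defs where

open import Data.Nat using (ℕ; _<?_; _≤_; _*_; _^_)
open import Data.Fin using (Fin; toℕ)
open import Data.Bool using (Bool; true; _∧_)
open import Data.List using (List; length; filterᵇ; allFin; cartesianProduct)
open import Data.Product using (Σ; ∃; _×_; _,_; proj₁; proj₂)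
open import Data.Sum using (_⊎_)
open import Relation.Nullary using (¬_)
open import Relation.Nullary.Decidable using (⌊_⌋)
open import Relation.Binary.PropositionalEquality using (_≡_)
open import Function.Definitions using (Injective)

record Graph : Set where
  field
    nv     : ℕ
    adj    : Fin nv → Fin nv → Bool
    sym    : ∀ i j → adj i j ≡ adj j i
    irrefl : ∀ i → adj i i ≡ Data.Bool.false
open Graph public

edgeList : (H : Graph) → List (Fin (nv H) × Fin (nv H))
edgeList H = filterᵇ (λ p → ⌊ toℕ (proj₁ p) <? toℕ (proj₂ p) ⌋ ∧ adj H (proj₁ p) (proj₂ p))
                     (cartesianProduct (allFin (nv H)) (allFin (nv H)))

numEdges : Graph → ℕ
numEdges H = length (edgeList H)

-- An edge colouring of K_n with k colours: a symmetric function on pairs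
-- (values on the diagonal are irrelevant: K_n has no loops).
EdgeColouring : ℕ → ℕ → Set
EdgeColouring n k = Fin n → Fin n → Fin k

IsSymmetric : ∀ {n k} → EdgeColouring n k → Set
IsSymmetric c = ∀ x y → c x y ≡ c y x

DistinctEdges : ∀ {h} → Fin h → Fin h → Fin h → Fin h → Set
DistinctEdges i j i' j' = ¬ ((i ≡ i' × j ≡ j') ⊎ (i ≡ j' × j ≡ i'))

-- The copy T of H given by the embedding φ : V(H) ↪ V(K_n) (vertex set
-- image φ, edge set {φ i φ j : ij ∈ E(H)}) is rainbow under colouring c.
Rainbow : ∀ {n k} (H : Graph) → (Fin (nv H) → Fin n) → EdgeColouring n k → Set
Rainbow H φ c = ∀ i j i' j' → adj H i j ≡ true → adj H i' j' ≡ true →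
                DistinctEdges i j i' j' → ¬ (c (φ i) (φ j) ≡ c (φ i') (φ j'))

-- There exist colourings f_v : E(K_n) → [k] (v ∈ V(K_n)) such that every copy
-- of H in K_n has a vertex v with f_v rainbow on that copy.
-- C(n,H) is the least k with Works n H k.
Works : ℕ → Graph → ℕ → Set
Works n H k =
  Σ (Fin n → EdgeColouring n k) λ f →
    (∀ v → IsSymmetric (f v)) ×
    (∀ (φ : Fin (nv H) → Fin n) → Injective _≡_ _≡_ φ →
       ∃ λ (u : Fin (nv H)) → Rainbow H φ (f (φ u)))

LowerBoundC : ℕ → Graph → ℕ → Set
LowerBoundC n H m = ∀ k → Works n H k → m ≤ k

{-# OPTIONS --safe #-}
module Submission where

-- Colour an h-tuple of vertices by all the values f_{x_i}(x_j x_l). If n exceeds a fixed power of k,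
-- a box argument gives two candidates for every coordinate such that all 2^h choices receive the
-- same colour. Group V(H) into classes of size at most two and place each class on the two candidates
-- of one coordinate: f_v then agrees on two edges ab, a'b' as soon as a, a' are in one class, b, b' in
-- another, and no endpoint is the classmate of v. Every graph with six edges contains one of K₁,₄, C₄,
-- two disjoint pairs of edges, or a triangle with three pendant edges, and each of these has
-- a grouping that provides such a pair of edges for every v.

open import Defs renaming (sym to adj-sym)
open import Data.Bool using (Bool; true; false; if_then_else_)
open import Data.Bool.Properties using (T-∧; T-≡; T?)
open import Data.Fin using (Fin; zero; suc; toℕ; inject≤; combine; funToFin; finToFun; #_)
open import Data.Fin.Properties using (_≟_; any?; all?; pigeonhole; toℕ-injective; <⇒≢; inject≤-injective; combine-injective; finToFun-funToFin)
open import Data.List using (List; []; _∷_; [_]; map; _++_; length; allFin; cartesianProduct)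
import Data.List as List
open import Data.List.Membership.Propositional.Properties using (∈-lookup)
open import Data.List.Relation.Unary.All as All using (All; []; _∷_)
import Data.List.Relation.Unary.All.Properties as All
open import Data.List.Relation.Unary.AllPairs using (_∷_)
open import Data.List.Relation.Unary.Any as Any using (Any; here; index)
import Data.List.Relation.Unary.Any.Properties as Any
open import Data.List.Relation.Unary.Unique.Propositional using (Unique)
import Data.List.Relation.Unary.Unique.Propositional.Properties as Unique
open import Data.Nat using (ℕ; zero; suc; _+_; _*_; _^_; _≤_; _<_; _≥_; z≤n; s≤s; _<?_; _≤?_)
open import Data.Nat.Properties hiding (_≤?_; _<?_; _≟_; <⇒≢)
open import Data.Product using (Σ; ∃; _×_; _,_; proj₁; proj₂; swap)
import Data.Product as Product
open import Data.Sum using (_⊎_; inj₁; inj₂)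
import Data.Sum as Sum
open import Data.Unit using (⊤; tt)
open import Data.Vec using (Vec; []; _∷_; lookup; zipWith; tabulate; replicate)
open import Data.Vec.Properties using (lookup-zipWith; lookup∘tabulate)
import Data.Vec.Functional as Functional
open import Function using (_∘_; _$_; Equivalence)
open import Function.Definitions using (Injective)
open import Relation.Binary using (Decidable; Symmetric; tri<; tri≈; tri>)
open import Relation.Binary.PropositionalEquality using (_≡_; _≢_; refl; sym; trans; cong; cong₂; subst; subst₂; module ≡-Reasoning)
open import Relation.Nullary using (Dec; yes; no; does; ¬_; ¬?; contradiction)
open import Relation.Nullary.Decidable using (_×-dec_; _⊎-dec_; _→-dec_; True; toWitness; dec-true; dec-false; decidable-stable)

-- Monochromatic boxes

corner : ∀ {N h} → Vec (Bool → Fin N) h → Vec Bool h → Vec (Fin N) h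
corner = zipWith _$_

private
  -- Removing one coordinate turns K colours into (K+1)²K, and (K+1)²K + 1 ≤ (K+1)³, so the exponent
  -- triples with each coordinate.
  box-arith : ∀ K h → suc (suc K * suc K * K) ^ (3 ^ h) ≤ suc K ^ (3 ^ suc h)
  box-arith K h = begin
    suc (suc K * suc K * K) ^ (3 ^ h)
      ≤⟨ ^-monoˡ-≤ (3 ^ h) (+-monoˡ-≤ (suc K * suc K * K) (s≤s (z≤n {K + K * suc K}))) ⟩
    (suc K * suc K + suc K * suc K * K) ^ (3 ^ h)
      ≡⟨ cong (_^ (3 ^ h)) (trans (sym (*-suc (suc K * suc K) K)) cube) ⟩
    (suc K ^ 3) ^ (3 ^ h)
      ≡⟨ ^-*-assoc (suc K) 3 (3 ^ h) ⟩
    suc K ^ (3 ^ suc h)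
      ∎
    where
    open ≤-Reasoning
    cube : suc K * suc K * suc K ≡ suc K ^ 3
    cube = trans (*-assoc (suc K) (suc K) (suc K)) (cong (λ t → suc K * (suc K * t)) (sym (*-identityʳ (suc K))))

-- The first coordinate is confined to K + 1 values, so every choice of the others yields a
-- collision; recording its position and colour is a colouring of the remaining coordinates.
monochromatic-box : ∀ h {K N} → suc K ^ (3 ^ h) ≤ N → (c : Vec (Fin N) h → Fin K) →
  ∃ λ y → (∀ i → lookup y i false ≢ lookup y i true) × (∀ s s' → c (corner y s) ≡ c (corner y s'))
monochromatic-box zero    _    c = [] , (λ ()) , λ { [] [] → refl }
monochromatic-box (suc h) {K} {N} size c =
  -- All corners of `y` agree under `c'`, hence have the same colliding pair, so the pair found at
  -- `z₀` serves them all.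
  (λ b → if b then e (snd z₀) else e (fst z₀)) ∷ y , distinct , λ s s' → trans (to-z₀ s) (sym (to-z₀ s'))
  where
  K+1≤N : suc K ≤ N
  K+1≤N = begin
    suc K               ≡⟨ ^-identityʳ (suc K) ⟨
    suc K ^ 1           ≤⟨ ^-monoʳ-≤ (suc K) (m^n>0 3 (suc h)) ⟩
    suc K ^ (3 ^ suc h) ≤⟨ size ⟩
    N                   ∎
    where open ≤-Reasoning

  e : Fin (suc K) → Fin N
  e i = inject≤ i K+1≤N

  collision : ∀ z → _
  collision z = pigeonhole (n<1+n K) (λ i → c (e i ∷ z))

  fst snd : Vec (Fin N) h → Fin (suc K)
  fst z = proj₁ (collision z)
  snd z = proj₁ (proj₂ (collision z))

  c' : Vec (Fin N) h → Fin (suc K * suc K * K)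
  c' z = combine (combine (fst z) (snd z)) (c (e (fst z) ∷ z))

  rest = monochromatic-box h (≤-trans (box-arith K h) size) c'
  y    = proj₁ rest
  z₀   = corner y (replicate h false)

  distinct : ∀ i → _
  distinct zero    eq = <⇒≢ (proj₁ (proj₂ (proj₂ (collision z₀)))) (inject≤-injective _ _ _ _ eq)
  distinct (suc i) eq = proj₁ (proj₂ rest) i eq

  same-collision : ∀ {z z'} → c' z ≡ c' z' →
    fst z ≡ fst z' × snd z ≡ snd z' × c (e (fst z) ∷ z) ≡ c (e (fst z') ∷ z')
  same-collision {z} {z'} eq
    with pos , colour ← combine-injective (combine (fst z) (snd z)) _ (combine (fst z') (snd z')) _ eq
    with fst≡ , snd≡ ← combine-injective (fst z) (snd z) (fst z') (snd z') pos
    = fst≡ , snd≡ , colour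

  to-z₀ : ∀ s → c (corner _ s) ≡ c (e (fst z₀) ∷ z₀)
  to-z₀ (b ∷ s)
    with fst≡ , snd≡ , colour ← same-collision (proj₂ (proj₂ rest) s (replicate h false))
    with b
  ... | false = trans (cong (λ i → c (e i ∷ corner y s)) (sym fst≡)) colour
  -- The collision at this corner trades its second index for its first, which leads back to the
  -- case `false`.
  ... | true  = trans (cong (λ i → c (e i ∷ corner y s)) (sym snd≡))
                  (trans (sym (proj₂ (proj₂ (proj₂ (collision (corner y s)))))) colour)

-- Twinnings

module _ {m} (rep : Fin m → Fin m) where

  -- An endpoint may be `v` but not its classmate, so candidates for `v`, `a` and `b` can be
  -- prescribed at their coordinates without conflict.
  Sees : Fin m → Fin m → Fin m → Set
  Sees v a b = rep a ≢ rep b × (rep a ≡ rep v → a ≡ v) × (rep b ≡ rep v → b ≡ v)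

  -- Two distinct edges that f_v will be forced to colour alike, since they run between the same two
  -- classes.
  Settled : (Fin m → Fin m → Set) → Fin m → Set
  Settled _~_ v = ∃ λ a → ∃ λ b → (a ~ b × Sees v a b) × ∃ λ a' → ∃ λ b' →
    (rep a ≡ rep a' × rep b ≡ rep b') × (a' ~ b' × Sees v a' b') × DistinctEdges a b a' b'

  -- A fibre of `rep` has at most one fixed point, its own value; allowing one moved point besides
  -- bounds its size by two.
  Separates : Set
  Separates = ∀ x y → rep x ≡ rep y → rep x ≢ x → rep y ≢ y → x ≡ y

  sees? : ∀ v a b → Dec (Sees v a b)
  sees? v a b = ¬? (rep a ≟ rep b) ×-dec (rep a ≟ rep v →-dec a ≟ v) ×-dec (rep b ≟ rep v →-dec b ≟ v)

  settled? : ∀ {_~_} → Decidable _~_ → ∀ v → Dec (Settled _~_ v)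
  settled? _~?_ v = any? λ a → any? λ b → (a ~? b ×-dec sees? v a b) ×-dec any? λ a' → any? λ b' →
    (rep a ≟ rep a' ×-dec rep b ≟ rep b') ×-dec (a' ~? b' ×-dec sees? v a' b') ×-dec
    ¬? ((a ≟ a' ×-dec b ≟ b') ⊎-dec (a ≟ b' ×-dec b ≟ a'))

  separates? : Dec Separates
  separates? = all? λ x → all? λ y → rep x ≟ rep y →-dec ¬? (rep x ≟ x) →-dec ¬? (rep y ≟ y) →-dec x ≟ y

-- The classes of a twinning are the fibres of rep; they have at most two elements.
record Twinning {m} (_~_ : Fin m → Fin m → Set) : Set where
  field
    rep       : Fin m → Fin m
    separates : Separates rep
    settled   : ∀ v → Settled rep _~_ v

_⊢_~_ : (H : Graph) → Fin (nv H) → Fin (nv H) → Set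
H ⊢ x ~ y = adj H x y ≡ true

~-symmetric : ∀ H → Symmetric (H ⊢_~_)
~-symmetric H {x} {y} = trans (adj-sym H y x)

-- From a twinning to an upper bound on n

module _ {H : Graph} (twinning : Twinning (H ⊢_~_)) {n k : ℕ} where
  open Twinning twinning

  private h = nv H

  side : Fin h → Bool
  side x = does (rep x ≟ x)

  rep-side-injective : ∀ x y → rep x ≡ rep y → side x ≡ side y → x ≡ y
  rep-side-injective x y rep≡ side≡ with rep x ≟ x | rep y ≟ y
  ... | yes p | yes q = trans (sym p) (trans rep≡ q)
  ... | no p  | no q  = separates x y rep≡ p q

  -- The order of the tests does no harm when `Sees` holds: an endpoint sharing the coordinate of
  -- `v` is `v` itself. The final default also fills the coordinates that are not read.
  selection : Fin h → Fin h → Fin h → Fin h → Bool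
  selection v a b i = if does (i ≟ rep v) then side v else if does (i ≟ rep a) then side a else side b

  module _ {v a b} (sees : Sees rep v a b) where

    selection-v : selection v a b (rep v) ≡ side v
    selection-v rewrite dec-true (rep v ≟ rep v) refl = refl

    selection-a : selection v a b (rep a) ≡ side a
    selection-a with rep a ≟ rep v
    ... | yes p = cong side (sym (proj₁ (proj₂ sees) p))
    ... | no _ rewrite dec-true (rep a ≟ rep a) refl = refl

    selection-b : selection v a b (rep b) ≡ side b
    selection-b with rep b ≟ rep v
    ... | yes p = cong side (sym (proj₂ (proj₂ sees) p))
    ... | no _ rewrite dec-false (rep b ≟ rep a) (proj₁ sees ∘ sym) = refl

  -- Otherwise K_n has room for `h` disjoint blocks of `N` vertices, one per coordinate. A
  -- monochromatic box in their product hosts a copy of `H` on which no f_v with v in the copy is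
  -- rainbow.
  Works⇒small : Works n H k → ¬ h * suc (((k ^ h) ^ h) ^ h) ^ (3 ^ h) ≤ n
  Works⇒small (f , _ , works) large = refute (works place place-injective)
    where
    N = suc (((k ^ h) ^ h) ^ h) ^ (3 ^ h)

    point : Fin h → Fin N → Fin n
    point i x = inject≤ (combine i x) large

    colours : Vec (Fin N) h → Fin h → Fin h → Fin h → Fin k
    colours x i j l = f (at i) (at j) (at l)
      where at = λ i → point i (lookup x i)

    -- Packing all h³ colours into one number lets a single box control them together.
    code : Vec (Fin N) h → Fin (((k ^ h) ^ h) ^ h)
    code x = funToFin λ i → funToFin λ j → funToFin (colours x i j)

    read : Fin (((k ^ h) ^ h) ^ h) → Fin h → Fin h → Fin h → Fin k
    read w i j = finToFun (finToFun (finToFun w i) j)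

    read-code : ∀ x i j l → read (code x) i j l ≡ colours x i j l
    read-code x i j l
      rewrite finToFun-funToFin (λ i → funToFin λ j → funToFin (colours x i j)) i
            | finToFun-funToFin (λ j → funToFin (colours x i j)) j = finToFun-funToFin (colours x i j) l

    box : _
    box = monochromatic-box h ≤-refl code

    y = proj₁ box

    place : Fin h → Fin n
    place x = point (rep x) (lookup y (rep x) (side x))

    place-injective : Injective _≡_ _≡_ place
    place-injective {x} {x'} eq
      with rep≡ , y≡ ← combine-injective (rep x) _ (rep x') _ (inject≤-injective large large _ _ eq)
      = rep-side-injective x x' rep≡
          (cancel (rep x) (side x) (side x') (trans y≡ (cong (λ i → lookup y i (side x')) (sym rep≡))))
      where
      cancel : ∀ i b b' → lookup y i b ≡ lookup y i b' → b ≡ b'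
      cancel i false false _  = refl
      cancel i false true  eq = contradiction eq (proj₁ (proj₂ box) i)
      cancel i true  false eq = contradiction (sym eq) (proj₁ (proj₂ box) i)
      cancel i true  true  _  = refl

    at-selection : ∀ (s : Fin h → Bool) x → s (rep x) ≡ side x →
      point (rep x) (lookup (corner y (tabulate s)) (rep x)) ≡ place x
    at-selection s x eq = cong (point (rep x)) (trans (lookup-zipWith _$_ (rep x) y (tabulate s))
      (cong (lookup y (rep x)) (trans (lookup∘tabulate s (rep x)) eq)))

    corner-of : Fin h → Fin h → Fin h → Vec (Fin N) h
    corner-of v a b = corner y (tabulate (selection v a b))

    colour-placed : ∀ {v a b} → Sees rep v a b →
      colours (corner-of v a b) (rep v) (rep a) (rep b) ≡ f (place v) (place a) (place b)
    colour-placed {v} {a} {b} sees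
      rewrite at-selection (selection v a b) v (selection-v sees)
            | at-selection (selection v a b) a (selection-a sees)
            | at-selection (selection v a b) b (selection-b sees) = refl

    colours-constant : ∀ s s' i j l → colours (corner y s) i j l ≡ colours (corner y s') i j l
    colours-constant s s' i j l = begin
      colours (corner y s) i j l      ≡⟨ read-code (corner y s) i j l ⟨
      read (code (corner y s)) i j l  ≡⟨ cong (λ w → read w i j l) (proj₂ (proj₂ box) s s') ⟩
      read (code (corner y s')) i j l ≡⟨ read-code (corner y s') i j l ⟩
      colours (corner y s') i j l     ∎
      where open ≡-Reasoning

    refute : ¬ ∃ λ u → Rainbow H place (f (place u))
    refute (u , rainbow)
      with a , b , (a~b , sees) , a' , b' , (ra , rb) , (a'~b' , sees') , different ← settled u
      = rainbow a b a' b' a~b a'~b' different (begin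
          f (place u) (place a) (place b)
            ≡⟨ colour-placed sees ⟨
          -- The two edges are read at different corners but in the same three coordinates, and all
          -- corners have the same code.
          colours (corner-of u a b) (rep u) (rep a) (rep b)
            ≡⟨ colours-constant (tabulate (selection u a b)) (tabulate (selection u a' b')) (rep u) (rep a) (rep b) ⟩
          colours (corner-of u a' b') (rep u) (rep a) (rep b)
            ≡⟨ cong₂ (colours (corner-of u a' b') (rep u)) ra rb ⟩
          colours (corner-of u a' b') (rep u) (rep a') (rep b')
            ≡⟨ colour-placed sees' ⟩
          f (place u) (place a') (place b')
            ∎)
      where open ≡-Reasoning

-- Copies of small graphs

Edges : ℕ → Set
Edges m = List (Fin m × Fin m)

Joins : ∀ {m} → Fin m → Fin m → Fin m × Fin m → Set
Joins a b (c , d) = (a ≡ c × b ≡ d) ⊎ (a ≡ d × b ≡ c)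

Adj : ∀ {m} → Edges m → Fin m → Fin m → Set
Adj E a b = Any (Joins a b) E

adj? : ∀ {m} (E : Edges m) → Decidable (Adj E)
adj? E a b = Any.any? (λ (c , d) → (a ≟ c ×-dec b ≟ d) ⊎-dec (a ≟ d ×-dec b ≟ c)) E

-- The new vertex is 0, joined to the vertices in ns; old labels are shifted by one.
extend : ∀ {m} → List (Fin m) → Edges m → Edges (suc m)
extend ns E = map (λ a → suc a , zero) ns ++ map (λ (a , b) → suc a , suc b) E

-- An arbitrary relation covers both copies in `H` and copies inside an explicit edge list, which
-- `copy-trans` composes.
record Copy {V : Set} (_~_ : V → V → Set) {m} (E : Edges m) : Set where
  field
    vertex    : Fin m → V
    injective : Injective _≡_ _≡_ vertex
    edge      : All (λ (a , b) → vertex a ~ vertex b) E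
open Copy

module _ {V : Set} {_~_ : V → V → Set} where

  copy-empty : Copy _~_ {0} []
  copy-empty = record { vertex = Functional.[] ; injective = λ { {()} } ; edge = [] }

  copy-edge : ∀ {m} {E : Edges m} (c : Copy _~_ E) {a b} → vertex c a ~ vertex c b → Copy _~_ ((a , b) ∷ E)
  copy-edge c a~b = record { vertex = vertex c ; injective = injective c ; edge = a~b ∷ edge c }

  copy-extend : ∀ {m} {E : Edges m} (c : Copy _~_ E) {x ns} →
    All (λ a → vertex c a ~ x) ns → (∀ a → vertex c a ≢ x) → Copy _~_ (extend ns E)
  copy-extend c {x} ns~x new = record
    { vertex    = x Functional.∷ vertex c
    ; injective = inj _ _
    ; edge      = All.++⁺ (All.map⁺ ns~x) (All.map⁺ (edge c))
    }
    where
    inj : ∀ a b → (x Functional.∷ vertex c) a ≡ (x Functional.∷ vertex c) b → a ≡ b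
    inj zero    zero    _  = refl
    inj zero    (suc b) eq = contradiction (sym eq) (new b)
    inj (suc a) zero    eq = contradiction eq (new a)
    inj (suc a) (suc b) eq = cong suc (injective c eq)

  module _ (symmetric : Symmetric _~_) where

    copy-adj : ∀ {m} {E : Edges m} (c : Copy _~_ E) {a b} → Adj E a b → vertex c a ~ vertex c b
    copy-adj c a~b with All.lookupAny (edge c) a~b
    ... | e , inj₁ (p , q) = subst₂ (λ a b → vertex c a ~ vertex c b) (sym p) (sym q) e
    ... | e , inj₂ (p , q) = subst₂ (λ a b → vertex c a ~ vertex c b) (sym p) (sym q) (symmetric e)

    copy-trans : ∀ {l m} {G : Edges l} {E : Edges m} → Copy _~_ G → Copy (Adj G) E → Copy _~_ E
    copy-trans c d = record
      { vertex    = vertex c ∘ vertex d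
      ; injective = injective d ∘ injective c
      ; edge      = All.map (copy-adj c) (edge d)
      }

-- Each vertex outside the copy becomes a class of its own, so it sees every pair of edges that some
-- vertex inside sees.
twinning-lift : ∀ {h m} {_~_ : Fin h → Fin h → Set} {E : Edges (suc m)} → Symmetric _~_ → Copy _~_ E →
  Twinning (Adj E) → Twinning _~_
twinning-lift {h} {m} {_~_} {E} symmetric c twinning = record
  { rep = rep' ; separates = separates' ; settled = settled' }
  where
  open Twinning twinning
  ρ = vertex c

  preimage? : ∀ x → Dec (∃ λ a → ρ a ≡ x)
  preimage? x = any? λ a → ρ a ≟ x

  rep' : Fin h → Fin h
  rep' x with preimage? x
  ... | yes (a , _) = ρ (rep a)
  ... | no _        = x

  rep'-ρ : ∀ a → rep' (ρ a) ≡ ρ (rep a)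
  rep'-ρ a with preimage? (ρ a)
  ... | yes (b , eq) = cong (ρ ∘ rep) (injective c eq)
  ... | no ∄a        = contradiction (a , refl) ∄a

  rep'-ρ-injective : ∀ {a b} → rep' (ρ a) ≡ rep' (ρ b) → rep a ≡ rep b
  rep'-ρ-injective {a} {b} eq = injective c (trans (sym (rep'-ρ a)) (trans eq (rep'-ρ b)))

  rep'-outside : ∀ {x} → ¬ (∃ λ a → ρ a ≡ x) → rep' x ≡ x
  rep'-outside {x} ∄a with preimage? x
  ... | yes ∃a = contradiction ∃a ∄a
  ... | no _   = refl

  separates' : Separates rep'
  separates' x y eq x-moved y-moved with preimage? x | preimage? y
  ... | yes (a , refl) | yes (b , refl) =
    cong ρ (separates a b (injective c eq) (x-moved ∘ cong ρ) (y-moved ∘ cong ρ))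
  ... | no _           | _      = contradiction refl x-moved
  ... | yes _          | no _   = contradiction refl y-moved

  sees-inside : ∀ {v a b} → Sees rep v a b → Sees rep' (ρ v) (ρ a) (ρ b)
  sees-inside (a≢b , a≡v , b≡v) =
    a≢b ∘ rep'-ρ-injective , cong ρ ∘ a≡v ∘ rep'-ρ-injective , cong ρ ∘ b≡v ∘ rep'-ρ-injective

  sees-outside : ∀ {x v a b} → ¬ (∃ λ a → ρ a ≡ x) → Sees rep v a b → Sees rep' x (ρ a) (ρ b)
  sees-outside {x} ∄a (a≢b , _) = a≢b ∘ rep'-ρ-injective , apart , apart
    where
    apart : ∀ {a} → rep' (ρ a) ≡ rep' x → ρ a ≡ x
    apart {a} eq = contradiction (rep a , trans (sym (rep'-ρ a)) (trans eq (rep'-outside ∄a))) ∄a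

  settle : ∀ {x v} → (∀ {a b} → Sees rep v a b → Sees rep' x (ρ a) (ρ b)) →
    Settled rep (Adj E) v → Settled rep' _~_ x
  settle lift (a , b , (a~b , sees) , a' , b' , (ra , rb) , (a'~b' , sees') , different) =
    ρ a , ρ b , (copy-adj symmetric c a~b , lift sees) , ρ a' , ρ b' , (cong-rep ra , cong-rep rb) ,
    (copy-adj symmetric c a'~b' , lift sees') ,
    different ∘ Sum.map (Product.map (injective c) (injective c)) (Product.map (injective c) (injective c))
    where
    cong-rep : ∀ {a b} → rep a ≡ rep b → rep' (ρ a) ≡ rep' (ρ b)
    cong-rep {a} {b} eq = trans (rep'-ρ a) (trans (cong ρ eq) (sym (rep'-ρ b)))

  settled' : ∀ x → Settled rep' _~_ x
  settled' x = by-cases (preimage? x)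
    where
    by-cases : Dec (∃ λ a → ρ a ≡ x) → Settled rep' _~_ x
    by-cases (yes (v , refl)) = settle sees-inside (settled v)
    -- Any vertex of the copy would do; the index `suc m` guarantees that `zero` exists.
    by-cases (no ∄a)          = settle (sees-outside ∄a) (settled zero)

-- The unavoidable graphs

infixl 4 _▸_
data Pattern : ℕ → Set where
  ε   : Pattern 0
  _▸_ : ∀ {m} → Pattern m → List (Fin m) → Pattern (suc m)

edges : ∀ {m} → Pattern m → Edges m
edges ε        = []
edges (P ▸ ns) = extend ns (edges P)

-- Recursion meets the newest vertex first, but a search should place the oldest first. The
-- continuation `Q` reverses the order, so that a bad partial map is dropped early.
Embeds : ∀ {l m} → Edges l → Pattern m → ((Fin m → Fin l) → Set) → Set
Embeds G ε        Q = Q Functional.[]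
Embeds G (P ▸ ns) Q = Embeds G P λ ρ → ∃ λ x →
  All (λ a → Adj G (ρ a) x) ns × (∀ a → ρ a ≢ x) × Q (x Functional.∷ ρ)

embeds? : ∀ {l m} (G : Edges l) (P : Pattern m) {Q} → (∀ ρ → Dec (Q ρ)) → Dec (Embeds G P Q)
embeds? G ε        Q? = Q? Functional.[]
embeds? G (P ▸ ns) Q? = embeds? G P λ ρ → any? λ x →
  All.all? (λ a → adj? G (ρ a) x) ns ×-dec all? (λ a → ¬? (ρ a ≟ x)) ×-dec Q? (x Functional.∷ ρ)

embeds⇒copy : ∀ {l m} {G : Edges l} (P : Pattern m) {Q} → Embeds G P Q →
  Σ (Copy (Adj G) (edges P)) (Q ∘ vertex)
embeds⇒copy ε        q   = copy-empty , q
embeds⇒copy (P ▸ ns) emb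
  with c , x , ns~x , new , q ← embeds⇒copy P emb = copy-extend c ns~x new , q

Shape : Set
Shape = ∃ Pattern

-- The bounds on the sizes only prune the search.
Contains : ∀ {l} → Edges l → Shape → Set
Contains {l} G (m , P) = (m ≤ l × length (edges P) ≤ length G) × Embeds G P λ _ → ⊤

contains? : ∀ {l} (G : Edges l) S → Dec (Contains G S)
contains? {l} G (m , P) = (m ≤? l ×-dec length (edges P) ≤? length G) ×-dec embeds? G P λ _ → yes tt

-- The added edge has two, one or no endpoints outside E.
Grows : List Shape → Shape → Set
Grows Ss (_ , P) = length (edges P) < 6 ×
  Any (Contains (extend [ zero ] (extend [] E))) Ss ×
  (∀ a → Any (Contains (extend [ a ] E)) Ss) ×
  (∀ a b → toℕ a < toℕ b → Adj E a b ⊎ Any (Contains ((a , b) ∷ E)) Ss)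
  where E = edges P

grows? : ∀ Ss S → Dec (Grows Ss S)
grows? Ss (_ , P) = length (edges P) <? 6 ×-dec covered? _ ×-dec (all? λ a → covered? _) ×-dec
  (all? λ a → all? λ b → toℕ a <? toℕ b →-dec (adj? (edges P) a b ⊎-dec covered? _))
  where
  covered? : ∀ {l} (G : Edges l) → Dec (Any (Contains G) Ss)
  covered? G = Any.any? (contains? G) Ss

record TwinnedShape : Set where
  field
    {size}   : ℕ
    graph    : Pattern (suc size)
    twinning : Twinning (Adj (edges graph))
open TwinnedShape

shape : TwinnedShape → Shape
shape S = _ , graph S

twin : ∀ {m} (P : Pattern (suc m)) (reps : Vec (Fin (suc m)) (suc m)) → let rep = lookup reps in
  {True (separates? rep)} → {True (all? (settled? rep (adj? (edges P))))} → TwinnedShape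
twin P reps {sep} {set} = record
  { graph = P ; twinning = record { rep = lookup reps ; separates = toWitness sep ; settled = toWitness set } }

infixl 4 _+K₂
_+K₂ : ∀ {m} → Pattern m → Pattern (2 + m)
P +K₂ = P ▸ [] ▸ [ # 0 ]

K₂     = ε +K₂
P₃     = K₂ ▸ [ # 0 ]
P₄     = P₃ ▸ [ # 0 ]
P₅     = P₄ ▸ [ # 0 ]
C₅     = P₄ ▸ # 0 ∷ # 3 ∷ []
K₃     = K₂ ▸ # 0 ∷ # 1 ∷ []
claw   = K₂ ▸ [ # 1 ] ▸ [ # 2 ]
paw    = K₃ ▸ [ # 0 ]
bull   = paw ▸ [ # 2 ]
chair  = claw ▸ [ # 0 ]
spider = chair ▸ [ # 2 ]

-- The vectors list the representatives of the vertices, the vertex added last coming first.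
twinned : List TwinnedShape
twinned =
    twin (claw ▸ [ # 3 ])                 (# 0 ∷ # 0 ∷ # 2 ∷ # 2 ∷ # 4 ∷ [])
  ∷ twin (P₃ ▸ # 0 ∷ # 2 ∷ [])            (# 0 ∷ # 1 ∷ # 0 ∷ # 1 ∷ [])
  -- Here and in the next two graphs, each vertex is settled by the pair of edges disjoint from its
  -- own pair.
  ∷ twin (P₃ ▸ [] ▸ [ # 0 ] ▸ [ # 0 ])    (# 0 ∷ # 1 ∷ # 0 ∷ # 3 ∷ # 4 ∷ # 3 ∷ [])
  ∷ twin (P₃ +K₂ +K₂)                     (# 0 ∷ # 1 ∷ # 0 ∷ # 1 ∷ # 4 ∷ # 5 ∷ # 4 ∷ [])
  ∷ twin (K₂ +K₂ +K₂ +K₂)                 (# 0 ∷ # 1 ∷ # 0 ∷ # 1 ∷ # 4 ∷ # 5 ∷ # 4 ∷ # 5 ∷ [])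
  -- Each pendant vertex is twinned with a triangle vertex other than its neighbour, in cyclic
  -- order.
  ∷ twin (bull ▸ [ # 4 ])                 (# 0 ∷ # 1 ∷ # 2 ∷ # 1 ∷ # 0 ∷ # 2 ∷ [])
  ∷ []

-- Level i lists the graphs with i edges that contain no member of twinned.
level₁ level₂ level₃ level₄ level₅ : List Shape
level₁ = (_ , K₂) ∷ []
level₂ = (_ , P₃) ∷ (_ , (K₂ +K₂)) ∷ []
level₃ = (_ , claw) ∷ (_ , K₃) ∷ (_ , P₄) ∷ (_ , (P₃ +K₂)) ∷ (_ , (K₂ +K₂ +K₂)) ∷ []
level₄ = (_ , paw) ∷ (_ , chair) ∷ (_ , (claw +K₂)) ∷ (_ , (K₃ +K₂)) ∷ (_ , P₅) ∷ (_ , (P₄ +K₂)) ∷ []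
level₅ = (_ , bull) ∷ (_ , (paw ▸ [ # 0 ])) ∷ (_ , (paw +K₂)) ∷ (_ , spider) ∷ (_ , C₅) ∷ []

-- A ladder with one added edge per rung. Each rung is a finite check, done by evaluating a Boolean,
-- and reaching the empty list means that only members of `twinned` are left.
data Leads : List Shape → Set where
  done : Leads []
  step : ∀ {Ss} Ts → does (All.all? (grows? (map shape twinned ++ Ts)) Ss) ≡ true → Leads Ts → Leads Ss

leads : Leads ((_ , ε) ∷ [])
leads = step level₁ refl $ step level₂ refl $ step level₃ refl $ step level₄ refl $ step level₅ refl $ step [] refl done

-- Climbing the levels inside H

joins-unique : ∀ {m} {x y x' y' u v : Fin m} → toℕ x < toℕ y → toℕ x' < toℕ y' →
  Joins x y (u , v) → Joins x' y' (u , v) → (x , y) ≡ (x' , y')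
joins-unique _   _     (inj₁ (refl , refl)) (inj₁ (refl , refl)) = refl
joins-unique x<y x'<y' (inj₁ (refl , refl)) (inj₂ (refl , refl)) = contradiction x'<y' (<-asym x<y)
joins-unique x<y x'<y' (inj₂ (refl , refl)) (inj₁ (refl , refl)) = contradiction x'<y' (<-asym x<y)
joins-unique _   _     (inj₂ (refl , refl)) (inj₂ (refl , refl)) = refl

adj-symmetric : ∀ {m} (E : Edges m) → Symmetric (Adj E)
adj-symmetric E = Any.map (Sum.swap ∘ Sum.map swap swap)

lookup-distinct : ∀ {A : Set} {xs : List A} → Unique xs →
  ∀ i j → toℕ i < toℕ j → List.lookup xs i ≢ List.lookup xs j
lookup-distinct (x∉xs ∷ _) zero    (suc j) _         = All.lookup x∉xs (∈-lookup j)
lookup-distinct (_ ∷ uniq) (suc i) (suc j) (s≤s i<j) = lookup-distinct uniq i j i<j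

does⇒ : ∀ {A : Set} (a? : Dec A) → does a? ≡ true → A
does⇒ (yes a) refl = a

module _ (H : Graph) where

  private
    _~_ = H ⊢_~_
    es  = edgeList H

  edges-unique : Unique es
  edges-unique = Unique.filter⁺ (λ p → T? _)
    (Unique.cartesianProduct⁺ (Unique.allFin⁺ (nv H)) (Unique.allFin⁺ (nv H)))

  edges-ordered : All (λ (x , y) → toℕ x < toℕ y × x ~ y) es
  edges-ordered = All.map (λ t → let x<y , x~y = Equivalence.to T-∧ t in toWitness x<y , Equivalence.to T-≡ x~y)
    (All.all-filter (λ p → T? _) (cartesianProduct (allFin (nv H)) (allFin (nv H))))

  Uncovered : ∀ {m} {E : Edges m} → Copy _~_ E → Fin (nv H) → Fin (nv H) → Set
  Uncovered {E = E} c x y = x ~ y × x ≢ y × (∀ a b → vertex c a ≡ x → vertex c b ≡ y → ¬ Adj E a b)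

  -- If every edge of `H` were covered, the pigeonhole principle would give two of them the same
  -- edge of `E`, and the two would coincide.
  uncovered-edge : ∀ {m} {E : Edges m} (c : Copy _~_ E) → length E < numEdges H → ∃ λ x → ∃ (Uncovered c x)
  uncovered-edge {E = E} c short = choose (any? λ i → ¬? (covered? i))
    where
    Covered : Fin (length es) → Set
    Covered i = Any (λ (a , b) → Joins (proj₁ e) (proj₂ e) (vertex c a , vertex c b)) E
      where e = List.lookup es i

    covered? : ∀ i → Dec (Covered i)
    covered? i = Any.any? (λ (a , b) → let x , y = List.lookup es i ; u = vertex c a ; v = vertex c b in
      (x ≟ u ×-dec y ≟ v) ⊎-dec (x ≟ v ×-dec y ≟ u)) E

    ordered : ∀ i → toℕ (proj₁ (List.lookup es i)) < toℕ (proj₂ (List.lookup es i))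
    ordered i = proj₁ (All.lookup edges-ordered (∈-lookup i))

    choose : Dec (∃ λ i → ¬ Covered i) → ∃ λ x → ∃ (Uncovered c x)
    choose (yes (i , free)) = _ , _ , proj₂ (All.lookup edges-ordered (∈-lookup i)) ,
      (λ x≡y → <-irrefl (cong toℕ x≡y) (ordered i)) ,
      λ _ _ a↦x b↦y → free ∘ Any.map
        (Sum.map (λ (p , q) → trans (sym a↦x) (cong (vertex c) p) , trans (sym b↦y) (cong (vertex c) q))
                 (λ (p , q) → trans (sym a↦x) (cong (vertex c) p) , trans (sym b↦y) (cong (vertex c) q)))
    choose (no ∄free) = contradiction same (lookup-distinct edges-unique i j i<j)
      where
      covered : ∀ i → Covered i
      covered i = decidable-stable (covered? i) λ free → ∄free (i , free)

      clash = pigeonhole short (index ∘ covered)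
      i = proj₁ clash
      j = proj₁ (proj₂ clash)
      i<j = proj₁ (proj₂ (proj₂ clash))

      same : List.lookup es i ≡ List.lookup es j
      same = joins-unique (ordered i) (ordered j) (Any.lookup-index (covered i))
        (subst (λ k → let x , y = List.lookup es j ; a , b = List.lookup E k in Joins x y (vertex c a , vertex c b))
          (sym (proj₂ (proj₂ (proj₂ clash)))) (Any.lookup-index (covered j)))

  CopyOf : Shape → Set
  CopyOf (_ , P) = Copy _~_ (edges P)

  contained-copy : ∀ {l Ss} {G : Edges l} → Copy _~_ G → Any (Contains G) Ss → Any CopyOf Ss
  contained-copy c = Any.map λ {S} (_ , emb) →
    copy-trans (~-symmetric H) c (proj₁ (embeds⇒copy (proj₂ S) emb))

  -- A copy with fewer than six edges misses an edge of `H`. Adding that edge gives one of the cases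
  -- of `Grows`, by how many of its endpoints lie in the copy.
  grow : ∀ {Ss} S → 6 ≤ numEdges H → Grows Ss S → CopyOf S → Any CopyOf Ss
  grow (_ , P) six (short , two-new , one-new , none-new) c
    with x , y , x~y , x≢y , free ← uncovered-edge c (<-≤-trans short six)
    with any? (λ a → vertex c a ≟ x) | any? (λ b → vertex c b ≟ y)
  ... | no x-new       | no y-new       = contained-copy (copy-extend c' (x~y ∷ []) y-new') two-new
    where
    c' = copy-extend c [] λ a a↦x → x-new (a , a↦x)
    y-new' : ∀ a → vertex c' a ≢ y
    y-new' zero    = x≢y
    y-new' (suc a) = λ a↦y → y-new (a , a↦y)
  ... | yes (a , refl) | no y-new       =
    contained-copy (copy-extend c (x~y ∷ []) λ b b↦y → y-new (b , b↦y)) (one-new a)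
  ... | no x-new       | yes (b , refl) =
    contained-copy (copy-extend c (~-symmetric H x~y ∷ []) λ a a↦x → x-new (a , a↦x)) (one-new b)
  -- `Grows` treats added edges with increasing labels only, so the edge is reversed if necessary.
  ... | yes (a , refl) | yes (b , refl) with <-cmp (toℕ a) (toℕ b)
  ...   | tri≈ _ a≡b _ = contradiction (cong (vertex c) (toℕ-injective a≡b)) x≢y
  ...   | tri< a<b _ _ = Sum.[ (λ a~b → contradiction a~b (free a b refl refl)) , contained-copy (copy-edge c x~y) ]
                           (none-new a b a<b)
  ...   | tri> _ _ b<a = Sum.[ (λ b~a → contradiction (adj-symmetric (edges P) b~a) (free a b refl refl))
                             , contained-copy (copy-edge c (~-symmetric H x~y)) ]
                           (none-new b a b<a)

  -- Each rung yields a member of `twinned` or a graph of the next level; the last level is empty,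
  -- so a twinned graph must turn up.
  climb : ∀ {Ss} → 6 ≤ numEdges H → Leads Ss → Any CopyOf Ss → Twinning _~_
  climb six (step {Ss} Ts grows rest) copies
    with Any.++⁻ (map shape twinned) (grow (Any.lookup copies) six (proj₁ grown) (proj₂ grown))
    where grown = All.lookupAny (does⇒ (All.all? (grows? (map shape twinned ++ Ts)) Ss) grows) copies
  ... | inj₂ copies' = climb six rest copies'
  ... | inj₁ copies' =
    let S , c = Any.satisfied (Any.map⁻ {f = shape} {xs = twinned} copies')
    in twinning-lift (~-symmetric H) c (twinning S)

  six-edges⇒twinning : 6 ≤ numEdges H → Twinning _~_
  six-edges⇒twinning six = climb six leads (here copy-empty)

-- The polynomial bound

^-distribʳ-* : ∀ t m n → (m * n) ^ t ≡ m ^ t * n ^ t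
^-distribʳ-* zero    m n = refl
^-distribʳ-* (suc t) m n = trans (cong (m * n *_) (^-distribʳ-* t m n))
  ([m*n]*[o*p]≡[m*o]*[n*p] m n (m ^ t) (n ^ t))

polynomial-bound : ∀ h {k} → 1 ≤ k →
  h * suc (((k ^ h) ^ h) ^ h) ^ (3 ^ h) ≤ h * 2 ^ (3 ^ h) * k ^ suc (h * h * h * 3 ^ h)
polynomial-bound h {k@(suc _)} k≥1 = begin
  h * suc K ^ t                       ≤⟨ *-monoʳ-≤ h (^-monoˡ-≤ t (+-mono-≤ K≥1 (m≤m+n K 0))) ⟩
  h * (2 * K) ^ t                     ≡⟨ cong (h *_) (^-distribʳ-* t 2 K) ⟩
  h * (2 ^ t * K ^ t)                 ≡⟨ *-assoc h (2 ^ t) (K ^ t) ⟨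
  h * 2 ^ t * K ^ t                   ≡⟨ cong (h * 2 ^ t *_) K^t ⟩
  -- The extra factor `k` keeps the exponent positive even when `h` is 0.
  h * 2 ^ t * k ^ (h * h * h * t)     ≤⟨ *-monoʳ-≤ (h * 2 ^ t) (^-monoʳ-≤ k (n≤1+n (h * h * h * t))) ⟩
  h * 2 ^ t * k ^ suc (h * h * h * t) ∎
  where
  open ≤-Reasoning
  t = 3 ^ h
  K = ((k ^ h) ^ h) ^ h
  K≡ : K ≡ k ^ (h * h * h)
  K≡ = trans (cong (_^ h) (^-*-assoc k h h)) (^-*-assoc k (h * h) h)
  K≥1 : 1 ≤ K
  K≥1 = subst (1 ≤_) (sym K≡) (m^n>0 k (h * h * h))
  K^t : K ^ t ≡ k ^ (h * h * h * t)
  K^t = trans (cong (_^ t) K≡) (^-*-assoc k (h * h * h) t)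

theorem7 : (H : Graph) → 6 ≤ numEdges H →
    ∃ λ (p : ℕ) → ∃ λ (q : ℕ) → ∃ λ (d : ℕ) → ∃ λ (N : ℕ) →
    1 ≤ p × 1 ≤ q ×
    (∀ n → n ≥ N → ∀ k → Works n H k → n ^ p ≤ d * k ^ q)
-- With p = 1, the inequality n ≤ d k^q says k ≥ (n/d)^(1/q), so b = 1/q.
theorem7 H six = 1 , suc (h * h * h * 3 ^ h) , h * 2 ^ (3 ^ h) , 1 , s≤s z≤n , s≤s z≤n , bound
  where
  h = nv H
  bound : ∀ n → n ≥ 1 → ∀ k → Works n H k → n ^ 1 ≤ h * 2 ^ (3 ^ h) * k ^ suc (h * h * h * 3 ^ h)
  -- As there is a vertex, f yields a colour, which rules out k = 0.
  bound (suc n) _ zero    (f , _) = contradiction (f zero zero zero) λ ()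
  bound n       _ (suc k) works   = begin
    n ^ 1                                             ≡⟨ ^-identityʳ n ⟩
    n                                                 ≤⟨ <⇒≤ (≰⇒> (Works⇒small {H} (six-edges⇒twinning H six) works)) ⟩
    h * suc (((suc k ^ h) ^ h) ^ h) ^ (3 ^ h)         ≤⟨ polynomial-bound h (s≤s z≤n) ⟩
    h * 2 ^ (3 ^ h) * suc k ^ suc (h * h * h * 3 ^ h) ∎
    where open ≤-Reasoning
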